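{- Let $\lambda\ge 0$ and $\mu\ge 0$, and let $G$ be a meshed graph satisfying the $(\lambda,\mu)$-bow metric. Then the hyperbolicity $\delta$ of $G$ satisfies $\delta\le 2(\lambda+\mu)+1$, and the slimness $\varsigma$ of $G$ satisfies $\varsigma\le \frac{13}{2}\lambda+5\mu+\frac52$ when $\lambda\le 2(\mu+1)$, and $\varsigma\le 6(\lambda+\mu)+\frac72$ otherwise.
   Context: All graphs are finite, simple, unweighted, undirected and connected, with shortest-path distance $d=d_G$. The interval is $I(u,v)=\{z: d(u,z)+d(z,v)=d(u,v)\}$. A graph satisfies the $(\lambda,\mu)$-bow metric if for all vertices $u,v,w,x$ with $v\in I(u,w)$, $w\in I(v,x)$ and $d(v,w)>\lambda$, one has $d(u,x)\ge d(u,v)+d(v,w)+d(w,x)-\mu$. $G$ is $\delta$-hyperbolic if for any four vertices $u,v,w,x$ the two largest of the sums $d(u,v)+d(w,x)$, $d(u,w)+d(v,x)$, $d(u,x)+d(v,w)$ differ by at most $2\delta$; the hyperbolicity is the least such $\delta$. A geodesic triangle $\Delta(u,v,w)$ is a union of shortest paths $P(u,v),P(v,w),P(w,u)$; it is $\varsigma$-slim if every vertex of each side is at distance at most $\varsigma$ from the union of the other two sides; the slimness of $G$ is the least $\varsigma$ such that all geodesic triangles are $\varsigma$-slim. $G$ is meshed if for any three vertices $u,v,w$ with $d(v,w)=2$ there is a common neighbor $x$ of $v$ and $w$ with $2d(u,x)\le d(u,v)+d(u,w)$.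
   Formalization: The parameters λ and μ are taken to be nonnegative rational numbers rather than nonnegative reals. -}

module Defs where

open import Data.Nat using (ℕ; zero; suc; _+_; _*_; _⊔_; _⊓_)
open import Data.Integer using (+_)
open import Data.Rational as ℚ using (ℚ; _/_)
open import Data.Fin using (Fin)
open import Data.Product using (Σ; ∃; _×_; _,_)
open import Data.Sum using (_⊎_)
open import Relation.Binary.PropositionalEquality using (_≡_)
open import Relation.Nullary using (¬_)

record Graph (n : ℕ) : Set₁ where
  field
    Adj   : Fin n → Fin n → Set
    sym   : ∀ {u v} → Adj u v → Adj v u
    irref : ∀ {u} → ¬ Adj u u

module _ {n : ℕ} (G : Graph n) where
  open Graph G

  data Walk : Fin n → Fin n → ℕ → Set where
    [_]  : ∀ u → Walk u u zero
    _∷_  : ∀ {u v w k} → Adj u v → Walk v w k → Walk u w (suc k)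

  data OnWalk : ∀ {u v k} → Fin n → Walk u v k → Set where
    here-end : ∀ {u} → OnWalk u [ u ]
    here     : ∀ {u v w k} {e : Adj u v} {p : Walk v w k} → OnWalk u (e ∷ p)
    there    : ∀ {u v w k z} {e : Adj u v} {p : Walk v w k} → OnWalk z p → OnWalk z (e ∷ p)

  IsDist : Fin n → Fin n → ℕ → Set
  IsDist u v k = Walk u v k × (∀ {m} → Walk u v m → k Data.Nat.≤ m)

  -- d is the distance function of G (this forces G to be connected).
  IsDistanceFunction : (Fin n → Fin n → ℕ) → Set
  IsDistanceFunction d = ∀ u v → IsDist u v (d u v)

module _ {n : ℕ} (G : Graph n) (d : Fin n → Fin n → ℕ) where
  open Graph G

  ⟦_⟧ : ℕ → ℚ
  ⟦ k ⟧ = + k / 1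

  InInterval : Fin n → Fin n → Fin n → Set
  InInterval z u v = d u z + d z v ≡ d u v

  BowMetric : ℚ → ℚ → Set
  BowMetric λ' μ = ∀ u v w x → InInterval v u w → InInterval w v x →
    λ' ℚ.< ⟦ d v w ⟧ →
    ⟦ d u v + d v w + d w x ⟧ ℚ.≤ ⟦ d u x ⟧ ℚ.+ μ

  Meshed : Set
  Meshed = ∀ u v w → d v w ≡ 2 →
    ∃ λ x → Adj v x × Adj w x × 2 * d u x Data.Nat.≤ d u v + d u w

  max3 : ℕ → ℕ → ℕ → ℕ
  max3 a b c = a ⊔ b ⊔ c

  mid3 : ℕ → ℕ → ℕ → ℕ
  mid3 a b c = (a ⊓ b) ⊔ ((a ⊔ b) ⊓ c)

  Hyperbolic : ℚ → Set
  Hyperbolic δ = ∀ u v w x →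
    let S₁ = d u v + d w x
        S₂ = d u w + d v x
        S₃ = d u x + d v w
    in ⟦ max3 S₁ S₂ S₃ ⟧ ℚ.≤ ⟦ mid3 S₁ S₂ S₃ ⟧ ℚ.+ (+ 2 / 1) ℚ.* δ

  NearWalk : ℚ → Fin n → ∀ {a b k} → Walk G a b k → Set
  NearWalk ς z p = ∃ λ y → OnWalk G y p × ⟦ d z y ⟧ ℚ.≤ ς

  Slim : ℚ → Set
  Slim ς = ∀ u v w
    (p : Walk G u v (d u v)) (q : Walk G v w (d v w)) (r : Walk G w u (d w u)) →
      (∀ z → OnWalk G z p → NearWalk ς z q ⊎ NearWalk ς z r)
    × (∀ z → OnWalk G z q → NearWalk ς z p ⊎ NearWalk ς z r)
    × (∀ z → OnWalk G z r → NearWalk ς z p ⊎ NearWalk ς z q)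

{-# OPTIONS --safe #-}
module Submission where

-- Let L, M be the integer parts of λ, μ. Distances in a meshed graph descend: if d(u,v) < d(u,w), some
-- neighbour of w towards v is closer to u. Hence metric triangles are equilateral, and every triple u, v, w has
-- an equilateral quasi-median: a metric triangle u′v′w′ with d(u,v) = d(u,u′) + d(u′,v′) + d(v′,v) and so on.
-- The bow inequality bounds the side of metric triangles by K = L + M + 1, then the thickness of intervals by
-- τ = 2L + K. Comparing the quasi-medians of u, v, w and of u, v, x gives the four-point condition with defect
-- τ + K ≤ 4(λ + μ) + 2. For slimness, a vertex z of the side uv satisfies d(u,z) + d(z,w) ≤ d(u,w) + τ + K or the
-- same with v for u, by the four-point condition. The quasi-median of u, w, z then leads from z to the opposite
-- side within (3τ + 2K)/2 = (11L + 5M + 5)/2, which is below both bounds of the theorem.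

open import Defs
open import Data.Nat using (ℕ)
open import Data.Fin using (Fin)

module _ where
  open import Data.Nat
  open import Data.Nat.Properties hiding (_≟_)
  open import Data.Nat.Induction using (<-wellFounded)
  open import Data.Nat.Tactic.RingSolver using (solve)
  open import Data.Fin.Properties using (any?) renaming (_≟_ to _≟ᶠ_)
  open import Data.List using (List; [])
  open import Data.Product using (∃; _×_; _,_; proj₁; proj₂)
  open import Data.Sum using (_⊎_; inj₁; inj₂)
  open import Function using (_∘_)
  open import Induction.WellFounded using (Acc; acc)
  open import Relation.Binary.PropositionalEquality
  open import Relation.Nullary using (yes; no; contradiction)
  open import Relation.Nullary.Decidable using (_×-dec_; ¬?; decidable-stable)

  -- Linear arithmetic over the natural numbers.

  -- A name for list extension that does not clash with the constructor of walks.
  infixr 5 _◂_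
  _◂_ : ℕ → List ℕ → List ℕ
  _◂_ = List._∷_

  infixr 6 _⊕_
  _⊕_ : ∀ {a b c e} → a ≤ b → c ≤ e → a + c ≤ b + e
  _⊕_ = +-mono-≤

  ≡⇒≤ : ∀ {a b} → a ≡ b → a ≤ b
  ≡⇒≤ = ≤-reflexive

  ≡⇒≥ : ∀ {a b} → a ≡ b → b ≤ a
  ≡⇒≥ e = ≤-reflexive (sym e)

  -- Farkas' rule: once the hypotheses are added up to A ≤ B, a semiring identity is left.
  linear : ∀ {A B l r} s → A ≤ B → l + B + s ≡ r + A → l ≤ r
  linear {A} {B} {l} {r} s A≤B e = +-cancelʳ-≤ A l r (begin
    l + A      ≤⟨ +-monoʳ-≤ l A≤B ⟩
    l + B      ≤⟨ m≤m+n (l + B) s ⟩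
    l + B + s  ≡⟨ e ⟩
    r + A      ∎)
    where open ≤-Reasoning

  half-< : ∀ a b c → 2 * a ≤ b + c → c < b → a < b
  half-< a b c p q = *-cancelˡ-< 2 a b (linear 0 (p ⊕ q) (solve (a ◂ b ◂ c ◂ [])))

  half-≤ : ∀ a b c k → 2 * a ≤ b + c → b ≤ k → c ≤ k → a ≤ k
  half-≤ a b c k p q r =
    *-cancelˡ-≤ 2 (linear 0 (p ⊕ q ⊕ r) (solve (a ◂ b ◂ c ◂ k ◂ [])))

  -- Here and in the next two lemmas the left sides are `τ + K` and `σ` written out, with `l` and
  -- `m` for the integer parts of λ and μ. The right sides are twice the hyperbolicity bound and
  -- twice the two slimness bounds, which keeps them in ℕ.
  τ+K≤ : ∀ l m → (l + l + suc (l + m)) + suc (l + m) ≤ 4 * l + 4 * m + 2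
  τ+K≤ l m = linear (m + m) (z≤n {0}) (solve (l ◂ m ◂ []))

  σ≤₁ : ∀ l m → 3 * (l + l + suc (l + m)) + 2 * suc (l + m) ≤ 13 * l + 10 * m + 5
  σ≤₁ l m = linear (2 * l + 5 * m) (z≤n {0}) (solve (l ◂ m ◂ []))

  σ≤₂ : ∀ l m → 3 * (l + l + suc (l + m)) + 2 * suc (l + m) ≤ 12 * l + 12 * m + 7
  σ≤₂ l m = linear (l + 7 * m + 2) (z≤n {0}) (solve (l ◂ m ◂ []))

  -- Walks: concatenation, reversal and cutting.

  module _ {n : ℕ} (G : Graph n) where
    open Graph G renaming (sym to Adj-sym)

    infixr 5 _++_
    _++_ : ∀ {u v w i j} → Walk G u v i → Walk G v w j → Walk G u w (i + j)
    [ _ ]   ++ q = q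
    (e ∷ p) ++ q = e ∷ (p ++ q)

    reverse : ∀ {u v k} → Walk G u v k → Walk G v u k
    reverse [ u ] = [ u ]
    reverse {k = suc k} (e ∷ p) =
      subst (Walk G _ _) (+-comm k 1) (reverse p ++ (Adj-sym e ∷ [ _ ]))

    split-at : ∀ i {u v k} (p : Walk G u v k) → i ≤ k →
      ∃ λ z → OnWalk G z p × Walk G u z i × Walk G z v (k ∸ i)
    split-at zero    p@([ _ ]) _ = _ , here-end , [ _ ] , p
    split-at zero    p@(_ ∷ _) _ = _ , here , [ _ ] , p
    split-at (suc i) (e ∷ p) (s≤s i≤k) with split-at i p i≤k
    ... | z , on , q , r = z , there on , e ∷ q , r

    split-on : ∀ {u v z k} {p : Walk G u v k} → OnWalk G z p →
      ∃ λ i → ∃ λ j → Walk G u z i × Walk G z v j × i + j ≡ k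
    split-on here-end             = 0 , 0 , [ _ ] , [ _ ] , refl
    split-on (here {e = e} {p})   = 0 , _ , [ _ ] , e ∷ p , refl
    split-on (there {e = e} on) with split-on on
    ... | i , j , q , r , eq = suc i , j , e ∷ q , r , cong suc eq

  -- Distances, intervals and geodesics.

  module _ {n : ℕ} (G : Graph n) (d : Fin n → Fin n → ℕ) (dist : IsDistanceFunction G d) where

    infix 4 _∈[_,_]
    _∈[_,_] : Fin n → Fin n → Fin n → Set
    z ∈[ u , v ] = InInterval G d z u v

    geodesic : ∀ u v → Walk G u v (d u v)
    geodesic u v = proj₁ (dist u v)

    d≤ : ∀ {u v k} → Walk G u v k → d u v ≤ k
    d≤ = proj₂ (dist _ _)

    d-refl : ∀ u → d u u ≡ 0
    d-refl u = n≤0⇒n≡0 (d≤ [ u ])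

    d≡0⇒≡ : ∀ {u v} → d u v ≡ 0 → u ≡ v
    d≡0⇒≡ {u} {v} e with subst (Walk G u v) e (geodesic u v)
    ... | [ _ ] = refl

    d-sym : ∀ u v → d u v ≡ d v u
    d-sym u v = ≤-antisym (d≤ (reverse G (geodesic v u))) (d≤ (reverse G (geodesic u v)))

    d-triangle : ∀ u v w → d u w ≤ d u v + d v w
    d-triangle u v w = d≤ (_++_ G (geodesic u v) (geodesic v w))

    between : ∀ {u v z} → d u z + d z v ≤ d u v → z ∈[ u , v ]
    between {u} {v} {z} p = ≤-antisym p (d-triangle u z v)

    ∈-sym : ∀ {u v z} → z ∈[ u , v ] → z ∈[ v , u ]
    ∈-sym {u} {v} {z} p =
      trans (cong₂ _+_ (d-sym v z) (d-sym z u)) (trans (+-comm (d z v) (d u z)) (trans p (d-sym u v)))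

    ∈-trans : ∀ {u v x y} → x ∈[ u , y ] → y ∈[ u , v ] → x ∈[ u , v ]
    ∈-trans {u} {v} {x} {y} p q = between
      (arith (d u x) (d x v) (d u v) (d x y) (d u y) (d y v) (≡⇒≤ p) (≡⇒≤ q) (d-triangle x y v))
      where
      arith : ∀ ux xv uv xy uy yv → ux + xy ≤ uy → uy + yv ≤ uv → xv ≤ xy + yv → ux + xv ≤ uv
      arith ux xv uv xy uy yv a b c =
        linear 0 (a ⊕ b ⊕ c) (solve (ux ◂ xv ◂ uv ◂ xy ◂ uy ◂ yv ◂ []))

    ∈-tail : ∀ {u v x y} → x ∈[ u , y ] → y ∈[ u , v ] → y ∈[ x , v ]
    ∈-tail {u} {v} {x} {y} p q = between
      (arith (d u x) (d x v) (d u v) (d x y) (d u y) (d y v) (≡⇒≤ p) (≡⇒≤ q) (d-triangle u x v))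
      where
      arith : ∀ ux xv uv xy uy yv → ux + xy ≤ uy → uy + yv ≤ uv → uv ≤ ux + xv → xy + yv ≤ xv
      arith ux xv uv xy uy yv a b c =
        linear 0 (a ⊕ b ⊕ c) (solve (ux ◂ xv ◂ uv ◂ xy ◂ uy ◂ yv ◂ []))

    point-at : ∀ {u v i} (p : Walk G u v (d u v)) → i ≤ d u v →
      ∃ λ z → OnWalk G z p × d u z ≡ i × z ∈[ u , v ]
    point-at {u} {v} {i} p i≤ with split-at G i p i≤
    ... | z , on , q , r = z , on , ≤-antisym (d≤ q) lower , between upper
      where
      lower : i ≤ d u z
      lower = +-cancelʳ-≤ (d u v ∸ i) _ _ (begin
        i + (d u v ∸ i)      ≡⟨ m+[n∸m]≡n i≤ ⟩
        d u v                ≤⟨ d-triangle u z v ⟩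
        d u z + d z v        ≤⟨ +-monoʳ-≤ (d u z) (d≤ r) ⟩
        d u z + (d u v ∸ i)  ∎)
        where open ≤-Reasoning
      upper : d u z + d z v ≤ d u v
      upper = ≤-trans (d≤ q ⊕ d≤ r) (≡⇒≤ (m+[n∸m]≡n i≤))

    on-geodesic⇒∈ : ∀ {u v z} {p : Walk G u v (d u v)} → OnWalk G z p → z ∈[ u , v ]
    on-geodesic⇒∈ on with split-on G on
    ... | i , j , q , r , e = between (≤-trans (d≤ q ⊕ d≤ r) (≡⇒≤ e))

    -- A first step from `w` on a geodesic to `v`, encoded by inequalities alone: the drop of the
    -- distance to `v` forces d(w,x) = 1.
    Toward : Fin n → Fin n → Fin n → Set
    Toward w v x = d w x ≤ 1 × suc (d x v) ≤ d w v

    toward-≡ : ∀ {w v x} → Toward w v x → d w v ≡ suc (d x v)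
    toward-≡ {w} {v} {x} (p , q) = ≤-antisym (≤-trans (d-triangle w x v) (p ⊕ ≤-refl)) q

    toward⇒∈ : ∀ {w v x} → Toward w v x → x ∈[ w , v ]
    toward⇒∈ {w} {v} {x} (p , q) = between (≤-trans (p ⊕ ≤-refl {d x v}) q)

    neighbour : ∀ {w v m} → d w v ≡ suc m → ∃ λ x → Toward w v x
    neighbour {w} {v} {m} e with point-at {i = 1} (geodesic w v) (≤-trans (s≤s z≤n) (≡⇒≥ e))
    ... | x , _ , p , q = x , ≡⇒≤ p , ≡⇒≤ (trans (cong (_+ d x v) (sym p)) q)

    -- Metric triangles and quasi-medians.

    Apex : Fin n → Fin n → Fin n → Set
    Apex u v w = ∀ x → x ∈[ u , v ] → x ∈[ u , w ] → u ≡ x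

    apex-swap : ∀ {u v w} → Apex u v w → Apex u w v
    apex-swap a x p q = a x q p

    MetricTriangle : Fin n → Fin n → Fin n → Set
    MetricTriangle u v w = Apex u v w × Apex v w u × Apex w u v

    -- The inequalities are equalities, by the triangle inequality.
    record QuasiMedian (u v w : Fin n) : Set where
      field
        u′ v′ w′ : Fin n
        metric : MetricTriangle u′ v′ w′
        uv : d u u′ + d u′ v′ + d v′ v ≤ d u v
        vw : d v v′ + d v′ w′ + d w′ w ≤ d v w
        wu : d w w′ + d w′ u′ + d u′ u ≤ d w u

      -- The memberships of the other two corners come from this one and the next by `rotate`.
      u′∈[u,v] : u′ ∈[ u , v ]
      u′∈[u,v] = between (arith (d u u′) (d u′ v′) (d v′ v) (d u′ v) (d u v) uv (d-triangle u′ v′ v))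
        where
        arith : ∀ a k b e f → a + k + b ≤ f → e ≤ k + b → a + e ≤ f
        arith a k b e f p q = linear 0 (p ⊕ q) (solve (a ◂ k ◂ b ◂ e ◂ f ◂ []))

      u′∈[w,u] : u′ ∈[ w , u ]
      u′∈[w,u] = between (arith (d w w′) (d w′ u′) (d u′ u) (d w u′) (d w u) wu (d-triangle w w′ u′))
        where
        arith : ∀ c k a e f → c + k + a ≤ f → e ≤ c + k → e + a ≤ f
        arith c k a e f p q = linear 0 (p ⊕ q) (solve (c ◂ k ◂ a ◂ e ◂ f ◂ []))

    rotate : ∀ {u v w} → QuasiMedian u v w → QuasiMedian v w u
    rotate q = record
      { u′ = v′ ; v′ = w′ ; w′ = u′
      ; metric = proj₁ (proj₂ metric) , proj₂ (proj₂ metric) , proj₁ metric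
      ; uv = vw ; vw = wu ; wu = uv }
      where open QuasiMedian q

    -- Some geodesics from `u` to `v` and to `w` both pass through `x`, so a quasi-median found from
    -- `x` also serves `u`; only the leg at `u` grows.
    extend : ∀ {u v w x} → x ∈[ u , v ] → x ∈[ u , w ] → QuasiMedian x v w → QuasiMedian u v w
    extend {u} {v} {w} {x} p q m = record
      { u′ = u′ ; v′ = v′ ; w′ = w′ ; metric = metric
      ; uv = arith₁ (d u u′) (d u x) (d x u′) (d u′ v′) (d v′ v) (d x v) (d u v)
               (d-triangle u x u′) uv (≡⇒≤ p)
      ; vw = vw
      ; wu = arith₂ (d u′ u) (d x u) (d u′ x) (d w′ u′) (d w w′) (d w x) (d w u)
               (d-triangle u′ x u) wu (≡⇒≤ (∈-sym {u} {w} {x} q)) }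
      where
      open QuasiMedian m
      arith₁ : ∀ uu′ ux xu′ k b xv uv →
        uu′ ≤ ux + xu′ → xu′ + k + b ≤ xv → ux + xv ≤ uv → uu′ + k + b ≤ uv
      arith₁ uu′ ux xu′ k b xv uv α β γ =
        linear 0 (α ⊕ β ⊕ γ) (solve (uu′ ◂ ux ◂ xu′ ◂ k ◂ b ◂ xv ◂ uv ◂ []))
      arith₂ : ∀ u′u xu u′x k c wx wu →
        u′u ≤ u′x + xu → c + k + u′x ≤ wx → wx + xu ≤ wu → c + k + u′u ≤ wu
      arith₂ u′u xu u′x k c wx wu α β γ =
        linear 0 (α ⊕ β ⊕ γ) (solve (u′u ◂ xu ◂ u′x ◂ k ◂ c ◂ wx ◂ wu ◂ []))

    Common : Fin n → Fin n → Fin n → Fin n → Set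
    Common u v w x = (x ∈[ u , v ] × x ∈[ u , w ]) × u ≢ x

    apex-or-common : ∀ u v w → Apex u v w ⊎ ∃ (Common u v w)
    apex-or-common u v w
      with any? (λ x → ((_ ≟ _) ×-dec (_ ≟ _)) ×-dec ¬? (u ≟ᶠ x))
    ... | yes c  = inj₂ c
    ... | no ¬c  = inj₁ λ x p q → decidable-stable (u ≟ᶠ x) λ u≢x → ¬c (x , (p , q) , u≢x)

    perimeter : Fin n → Fin n → Fin n → ℕ
    perimeter u v w = d u v + d v w + d w u

    perimeter-rotate : ∀ u v w → perimeter v w u ≡ perimeter u v w
    perimeter-rotate u v w = arith (d u v) (d v w) (d w u)
      where
      arith : ∀ a b c → b + c + a ≡ a + b + c
      arith a b c = solve (a ◂ b ◂ c ◂ [])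

    perimeter-common : ∀ {u v w x} → Common u v w x → perimeter x v w < perimeter u v w
    perimeter-common {u} {v} {w} {x} ((p , q) , u≢x) =
      arith (d x v) (d v w) (d w x) (d u v) (d w u) (d u x) (d x u)
        (≡⇒≤ p) (≡⇒≤ (∈-sym {u} {w} {x} q)) (n≢0⇒n>0 (u≢x ∘ d≡0⇒≡))
      where
      arith : ∀ xv vw wx uv wu ux xu →
        ux + xv ≤ uv → wx + xu ≤ wu → 1 ≤ ux → suc (xv + vw + wx) ≤ uv + vw + wu
      arith xv vw wx uv wu ux xu α β γ =
        linear xu (α ⊕ β ⊕ γ) (solve (xv ◂ vw ◂ wx ◂ uv ◂ wu ◂ ux ◂ xu ◂ []))

    -- Induction on the perimeter: a corner whose two intervals share another vertex moves there,
    -- which shortens the perimeter. If no corner can move, the triple is itself a metric triangle.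
    -- Rotations reduce the second and third corner to the first.
    quasiMedian : ∀ u v w → QuasiMedian u v w
    quasiMedian u v w = go u v w (<-wellFounded _)
      where
      go : ∀ u v w → Acc _<_ (perimeter u v w) → QuasiMedian u v w
      go u v w (acc rs) with apex-or-common u v w
      ... | inj₂ (x , c@((p , q) , _)) = extend p q (go x v w (rs (perimeter-common c)))
      ... | inj₁ a with apex-or-common v w u
      ...   | inj₂ (x , c@((p , q) , _)) = rotate (rotate (extend p q
                (go x w u (rs (subst (perimeter x w u <_) (perimeter-rotate u v w) (perimeter-common c))))))
      ...   | inj₁ b with apex-or-common w u v
      ...     | inj₂ (x , c@((p , q) , _)) = rotate (extend p q
                  (go x u v (rs (subst (perimeter x u v <_)
                    (trans (perimeter-rotate v w u) (perimeter-rotate u v w)) (perimeter-common c)))))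
      ...     | inj₁ c = record
                  { u′ = u ; v′ = v ; w′ = w ; metric = a , b , c
                  ; uv = arith u v ; vw = arith v w ; wu = arith w u }
        where
        arith : ∀ x y → d x x + d x y + d y y ≤ d x y
        arith x y rewrite d-refl x | d-refl y = ≡⇒≤ (+-identityʳ (d x y))

    -- Meshed graphs: descent of distances along geodesics.

    module _ (meshed : Meshed G d) where

      -- Opaque definitions keep with-abstraction from unfolding the solver's proof terms.
      opaque
        bridge : ∀ {w v x y} u → Toward w v x → Toward x v y →
          ∃ λ z → Toward w v z × 2 * d u z ≤ d u w + d u y
        bridge {w} {v} {x} {y} u (p , q) (p′ , q′)
          -- Two steps along a geodesic to `v` put `y` at distance 2 from `w`. A common neighbour of
          -- both is again a first step from `w` towards `v`, because it is adjacent to `y`.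
          with meshed u w y (≤-antisym (≤-trans (d-triangle w x y) (p ⊕ p′))
                 (arith₁ (d w y) (d y v) (d x v) (d w v) q q′ (d-triangle w y v)))
          where
          arith₁ : ∀ wy yv xv wv → suc xv ≤ wv → suc yv ≤ xv → wv ≤ wy + yv → 2 ≤ wy
          arith₁ wy yv xv wv α β γ = linear 0 (α ⊕ β ⊕ γ) (solve (wy ◂ yv ◂ xv ◂ wv ◂ []))
        ... | z , wz , yz , f = z , (adj wz , arith₂ (d z v) (d y v) (d x v) (d w v) q q′
                (≤-trans (d-triangle z y v) (adj (Graph.sym G yz) ⊕ ≤-refl))) , f
          where
          adj : ∀ {a b} → Graph.Adj G a b → d a b ≤ 1
          adj e = d≤ (e ∷ [ _ ])
          arith₂ : ∀ zv yv xv wv → suc xv ≤ wv → suc yv ≤ xv → zv ≤ 1 + yv → suc zv ≤ wv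
          arith₂ zv yv xv wv α β γ = linear 0 (α ⊕ β ⊕ γ) (solve (zv ◂ yv ◂ xv ◂ wv ◂ []))

      -- Induction on d(w,v). If a first step `x` does not come closer to `u`, the induction
      -- hypothesis makes the step after it descend, and `bridge` replaces `x` by a vertex whose
      -- distance to `u` is at most the mean of those at both ends.
      descend : ∀ {u v w} m → d w v ≡ m → d u v < d u w → ∃ λ x → Toward w v x × d u x < d u w
      descend {u} zero e f = contradiction (cong (d u) (sym (d≡0⇒≡ e))) (<⇒≢ f)
      descend {u} {v} {w} (suc m) e f = start (neighbour e)
        where
        shorter : ∀ {x} → Toward w v x → d x v ≡ m
        shorter t = suc-injective (trans (sym (toward-≡ t)) e)

        flat : ∀ {x} → Toward w v x → d u x ≤ d u w → ∃ λ z → Toward w v z × d u z < d u w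
        flat t p with m≤n⇒m<n∨m≡n p
        ... | inj₁ q = _ , t , q
        ... | inj₂ q with descend m (shorter t) (subst (d u v <_) (sym q) f)
        ...   | y , t₁ , r with bridge u t t₁
        ...     | z , t₂ , g = z , t₂ , half-< (d u z) (d u w) (d u y) g (subst (d u y <_) q r)

        start : ∃ (Toward w v) → ∃ λ z → Toward w v z × d u z < d u w
        start (x , t) with d u x ≤? d u w
        ... | yes p = flat t p
        -- If `x` climbs, then d(u,y) < d(u,x) ≤ d(u,w) + 1, so the bridge only yields a step that
        -- does not climb; `flat` then makes it descend.
        ... | no ¬p with descend m (shorter t) (<-trans f (≰⇒> ¬p))
        ...   | y , t₁ , r with bridge u t t₁
        ...     | z , t₂ , g = flat t₂ (half-≤ (d u z) (d u w) (d u y) (d u w) g ≤-refl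
                    (arith (d u y) (d u x) (d u w) (d w x) r (proj₁ t) (d-triangle u w x)))
          where
          arith : ∀ uy ux uw wx → suc uy ≤ ux → wx ≤ 1 → ux ≤ uw + wx → uy ≤ uw
          arith uy ux uw wx α β γ = linear 0 (α ⊕ β ⊕ γ) (solve (uy ◂ ux ◂ uw ◂ wx ◂ []))

      -- If the first step `x` leaves the ball of radius `k` around `u`, then d(u,v) < d(u,x) and
      -- `descend` brings the next step back into the ball. Both ends of the bridge are then in the
      -- ball, and hence so is the new first step.
      sublevel-step : ∀ {u v w k m} → d w v ≡ suc m → d u w ≤ k → d u v ≤ k →
        ∃ λ x → Toward w v x × d u x ≤ k
      sublevel-step {u} {v} {w} {k} e p q with neighbour e
      ... | x , t with d u x ≤? k
      ...   | yes r = x , t , r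
      ...   | no ¬r with descend _ refl (≤-<-trans q (≰⇒> ¬r))
      ...     | y , t₁ , r with bridge u t t₁
      ...       | z , t₂ , g = z , t₂ , half-≤ (d u z) (d u w) (d u y) k g p
                    (arith (d u y) (d u x) (d u w) (d w x) r (proj₁ t) (d-triangle u w x) p)
        where
        arith : ∀ uy ux uw wx → suc uy ≤ ux → wx ≤ 1 → ux ≤ uw + wx → uw ≤ k → uy ≤ k
        arith uy ux uw wx α β γ δ = linear 0 (α ⊕ β ⊕ γ ⊕ δ) (solve (uy ◂ ux ◂ uw ◂ wx ◂ k ◂ []))

      -- Iterating the step follows a geodesic from `w` to `v` inside the ball.
      sublevel-path : ∀ {u v w k} i j → d w v ≡ i + j → d u w ≤ k → d u v ≤ k →
        ∃ λ z → d w z ≡ i × d z v ≡ j × d u z ≤ k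
      sublevel-path {w = w} zero j e p q = w , d-refl w , e , p
      sublevel-path {u} {v} {w} (suc i) j e p q with sublevel-step e p q
      ... | x , t , r with sublevel-path i j (suc-injective (trans (sym (toward-≡ t)) e)) r q
      ...   | z , xz , zv , f = z
              , ≤-antisym (≤-trans (d-triangle w x z) (proj₁ t ⊕ ≡⇒≤ xz))
                  (+-cancelʳ-≤ j (suc i) (d w z)
                    (≤-trans (≡⇒≥ e) (≤-trans (d-triangle w z v) (≤-refl ⊕ ≡⇒≤ zv))))
              , zv , f

      -- If `p` were closer to `w` than `u` is, the descent from `u` towards `p` would begin with a
      -- vertex other than `u` in both intervals at the apex.
      apex-nearest : ∀ {u v w p} → Apex u v w → p ∈[ u , v ] → d w u ≤ d w p
      apex-nearest {u} {v} {w} {p} a p∈ with d w u ≤? d w p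
      ... | yes q = q
      ... | no ¬q with descend _ refl (≰⇒> ¬q)
      ...   | x , t , r = contradiction u≡x λ e → <⇒≢ r (cong (d w) (sym e))
        where
        u≡x : u ≡ x
        u≡x = a x (∈-trans (toward⇒∈ t) p∈) (between (≤-trans (proj₁ t ⊕ ≤-refl)
          (≤-trans (s≤s (≡⇒≤ (d-sym x w))) (≤-trans r (≡⇒≤ (d-sym w u))))))

      apex-≤ : ∀ {u v w} → Apex u v w → d w u ≤ d w v
      apex-≤ {u} {v} a = apex-nearest a (trans (cong (d u v +_) (d-refl v)) (+-identityʳ _))

      equilateral : ∀ {u v w} → MetricTriangle u v w → d u v ≡ d v w × d u v ≡ d w u
      equilateral {u} {v} {w} (a , b , c) =
          ≤-antisym (subst (_≤ d v w) (d-sym v u) (apex-≤ (apex-swap a)))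
                    (subst (d v w ≤_) (d-sym v u) (apex-≤ c))
        , ≤-antisym (subst (d u v ≤_) (d-sym u w) (apex-≤ b))
                    (subst (_≤ d u v) (d-sym u w) (apex-≤ (apex-swap c)))

      -- The bow inequality: sides of metric triangles and thickness of intervals.

      module _ (L M : ℕ)
        (bow : ∀ u v w x → v ∈[ u , w ] → w ∈[ v , x ] → L < d v w →
               d u v + d v w + d w x ≤ d u x + M) where

        K τ : ℕ
        K = suc (L + M)
        τ = L + L + K

        -- With z on the side vw at distance L + 1 from v and equally far from u as the corners, the quasi-median
        -- of v, z, u has the corner v, and its corner p at u yields the bow u, p, z, w.
        opaque
          side-bound : ∀ {u v w} → MetricTriangle u v w → d v w ≤ K
          side-bound {u} {v} {w} t@(a , b , c) with d v w ≤? L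
          ... | yes s = ≤-trans s (m≤n⇒m≤1+n (m≤m+n L M))
          ... | no ¬s = arith (d v w) (d u w) (d u p) (d p z) (d z w) (d v p)
                  (bow u p z w p∈[u,z] z∈[p,w] L<pz) uw≤vw
                  (≤-trans vw≤uv (≤-trans (≡⇒≤ (d-sym u v))
                    (≤-trans (d-triangle v p u) (≤-refl ⊕ ≡⇒≤ (d-sym p u)))))
                  vp≤ vw≤
            where
            e : d v w ≡ suc L + (d v w ∸ suc L)
            e = sym (m+[n∸m]≡n (≰⇒> ¬s))

            vw≤uv : d v w ≤ d u v
            vw≤uv = ≡⇒≥ (proj₁ (equilateral t))

            uw≤vw : d u w ≤ d v w
            uw≤vw = ≤-trans (≡⇒≤ (d-sym u w))
              (≡⇒≤ (trans (sym (proj₂ (equilateral t))) (proj₁ (equilateral t))))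

            path : ∃ λ z → d v z ≡ suc L × d z w ≡ d v w ∸ suc L × d u z ≤ d v w
            path = sublevel-path (suc L) (d v w ∸ suc L) e (≡⇒≤ (proj₁ (equilateral t))) uw≤vw

            z : Fin n
            z = proj₁ path

            vz : d v z ≡ suc L
            vz = proj₁ (proj₂ path)

            z∈[v,w] : z ∈[ v , w ]
            z∈[v,w] = trans (cong₂ _+_ vz (proj₁ (proj₂ (proj₂ path)))) (sym e)

            q : QuasiMedian v z u
            q = quasiMedian v z u

            open QuasiMedian q renaming (w′ to p)
            open QuasiMedian (rotate (rotate q)) using () renaming (u′∈[u,v] to p∈[u,v]; u′∈[w,u] to p∈[z,u])

            -- The corner at `v` lies in I(v,z), hence in I(v,w), and also in I(v,u), so the apex
            -- condition at `v` applies.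
            v≡u′ : v ≡ u′
            v≡u′ = b u′ (∈-trans u′∈[u,v] z∈[v,w]) (∈-sym u′∈[w,u])

            p∈[u,z] : p ∈[ u , z ]
            p∈[u,z] = ∈-sym p∈[z,u]

            vp≤ : d v p ≤ suc L
            vp≤ = begin
              d v p                       ≡⟨ cong (λ x → d x p) v≡u′ ⟩
              d u′ p                      ≡⟨ d-sym u′ p ⟩
              d p u′                      ≡⟨ proj₂ (equilateral metric) ⟨
              d u′ v′                     ≤⟨ m≤n+m _ (d v u′) ⟩
              d v u′ + d u′ v′            ≤⟨ m≤m+n _ (d v′ z) ⟩
              d v u′ + d u′ v′ + d v′ z   ≤⟨ uv ⟩
              d v z                       ≡⟨ vz ⟩
              suc L                       ∎
              where open ≤-Reasoning

            pz≤ : d p z ≤ d v z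
            pz≤ = begin
              d p z                       ≤⟨ d-triangle p v′ z ⟩
              d p v′ + d v′ z             ≡⟨ cong (_+ d v′ z) (d-sym p v′) ⟩
              d v′ p + d v′ z             ≡⟨ cong (_+ d v′ z) (proj₁ (equilateral metric)) ⟨
              d u′ v′ + d v′ z            ≤⟨ +-monoˡ-≤ (d v′ z) (m≤n+m _ (d v u′)) ⟩
              d v u′ + d u′ v′ + d v′ z   ≤⟨ uv ⟩
              d v z                       ∎
              where open ≤-Reasoning

            -- No vertex of I(v,u) is closer to `w` than `v`. Compared with d(p,z) ≤ d(v,z), this
            -- puts `z` on a geodesic from `p` to `w` and forces d(p,z) = L + 1, just long enough
            -- for the bow inequality.
            vw≤pw : d v w ≤ d p w
            vw≤pw = subst₂ _≤_ (d-sym w v) (d-sym w p) (apex-nearest (apex-swap b) (∈-sym p∈[u,v]))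

            vw≤ : d v w ≤ d p z + d z w
            vw≤ = ≤-trans vw≤pw (d-triangle p z w)

            z∈[p,w] : z ∈[ p , w ]
            z∈[p,w] = between (≤-trans (pz≤ ⊕ ≤-refl) (≤-trans (≡⇒≤ z∈[v,w]) vw≤pw))

            L<pz : suc L ≤ d p z
            L<pz = subst (_≤ d p z) vz
              (+-cancelʳ-≤ (d z w) (d v z) (d p z) (≤-trans (≡⇒≤ z∈[v,w]) vw≤))

            -- With d(u,p) ≥ d(v,w) - (L + 1), the bow inequality becomes 2d(v,w) - (L + 1) ≤ d(v,w)
            -- + M.
            arith : ∀ vw uw up pz zw vp → up + pz + zw ≤ uw + M → uw ≤ vw → vw ≤ vp + up →
              vp ≤ suc L → vw ≤ pz + zw → vw ≤ suc (L + M)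
            arith vw uw up pz zw vp α β γ δ ε = linear 0 (α ⊕ β ⊕ γ ⊕ δ ⊕ ε)
              (solve (vw ◂ uw ◂ up ◂ pz ◂ zw ◂ vp ◂ L ◂ M ◂ []))

        opaque
          side≤K : ∀ {u v w} → MetricTriangle u v w → d u v ≤ K
          side≤K t = ≤-trans (≡⇒≤ (proj₁ (equilateral t))) (side-bound t)

        -- In the quasi-median of x, y, u, the leg x u′ is at most L, or else v, x, u′, y is a bow.
        opaque
          thin : ∀ {u v x y} → x ∈[ u , v ] → y ∈[ u , v ] → d u x ≡ d u y → d x y ≤ τ
          thin {u} {v} {x} {y} x∈ y∈ ux≡uy with d x (QuasiMedian.u′ (quasiMedian x y u)) ≤? L
          -- Equal levels make the leg at `y` no longer than the leg at `x`, so both are at most L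
          -- and the side between them is at most K.
          ... | yes s = arith (d x y) (d x u′) (d u′ y) (d u′ v′) (d v′ y) (d u w′) (d u x) K
                  s (side≤K metric) (d-triangle x u′ y) (d-triangle u′ v′ y)
                  (≤-trans (d-triangle u w′ x) (≤-refl ⊕ ≤-trans (d-triangle w′ u′ x)
                    (≡⇒≥ (proj₂ (equilateral metric)) ⊕ ≡⇒≤ (d-sym u′ x))))
                  (subst₂ _≤_
                    (cong₂ _+_ (cong₂ _+_ (d-sym y v′) (sym (proj₁ (equilateral metric)))) (d-sym w′ u))
                    (trans (d-sym y u) (sym ux≡uy)) vw)
            where
            open QuasiMedian (quasiMedian x y u)
            arith : ∀ xy xx′ x′y k b c ux K → xx′ ≤ L → k ≤ K → xy ≤ xx′ + x′y → x′y ≤ k + b →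
              ux ≤ c + (k + xx′) → b + k + c ≤ ux → xy ≤ L + L + K
            arith xy xx′ x′y k b c ux K α β γ δ ε ζ = linear 0 (α ⊕ α ⊕ β ⊕ γ ⊕ δ ⊕ ε ⊕ ζ)
              (solve (xy ◂ xx′ ◂ x′y ◂ k ◂ b ◂ c ◂ ux ◂ K ◂ L ◂ []))
          -- Here `x` lies in I(v,u′) because `u′` lies in I(u,x). Equal levels give d(v,y) ≤
          -- d(v,x), so the bow inequality leaves d(x,y) ≤ M.
          ... | no ¬s = arith (d x y) (d v x) (d x u′) (d u′ y) (d v y) (d u x) (d u y) (d u v)
                  (bow v x u′ y (∈-sym (∈-tail u′∈[w,u] x∈)) u′∈[u,v] (≰⇒> ¬s))
                  (d-triangle x u′ y)
                  (≤-trans (d-triangle u x v) (≤-refl ⊕ ≡⇒≤ (d-sym x v)))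
                  (subst (λ t → d u y + t ≤ d u v) (d-sym y v) (≡⇒≤ y∈)) (≡⇒≤ ux≡uy)
            where
            open QuasiMedian (quasiMedian x y u)
            arith : ∀ xy vx xx′ x′y vy ux uy uv → vx + xx′ + x′y ≤ vy + M → xy ≤ xx′ + x′y →
              uv ≤ ux + vx → uy + vy ≤ uv → ux ≤ uy → xy ≤ L + L + suc (L + M)
            arith xy vx xx′ x′y vy ux uy uv α β γ δ ε = linear (1 + L + L + L) (α ⊕ β ⊕ γ ⊕ δ ⊕ ε)
              (solve (xy ◂ vx ◂ xx′ ◂ x′y ◂ vy ◂ ux ◂ uy ◂ uv ◂ L ◂ M ◂ []))

        -- The four-point condition.

        opaque
          -- Compare `x` with the vertex of its own level on a geodesic from `u` to `y`.
          level : ∀ {u v x y} → x ∈[ u , v ] → y ∈[ u , v ] → d u x ≤ d u y →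
            d x y + d u x ≤ τ + d u y
          level {u} {v} {x} {y} x∈ y∈ p with point-at (geodesic u y) p
          ... | z , _ , uz≡ux , z∈ = arith (d x y) (d u x) (d u y) (d x z) (d z y) (d u z) τ
                (thin x∈ (∈-trans z∈ y∈) (sym uz≡ux)) (d-triangle x z y) (≡⇒≥ uz≡ux) (≡⇒≤ z∈)
            where
            arith : ∀ xy ux uy xz zy uz t → xz ≤ t → xy ≤ xz + zy → ux ≤ uz → uz + zy ≤ uy →
              xy + ux ≤ t + uy
            arith xy ux uy xz zy uz t α β γ δ = linear 0 (α ⊕ β ⊕ γ ⊕ δ)
              (solve (xy ◂ ux ◂ uy ◂ xz ◂ zy ◂ uz ◂ t ◂ []))

        -- The path from w to x through the corners of the two quasi-medians at u.
        opaque
          four-point-ordered : ∀ {u v w x} (q : QuasiMedian u v w) (r : QuasiMedian u v x) →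
            d u (QuasiMedian.u′ q) ≤ d u (QuasiMedian.u′ r) →
            d u v + d w x ≤ d u x + d v w + (τ + K)
          four-point-ordered {u} {v} {w} {x} q r p = arith
              (d u v) (d w x) (d u x) (d v w) (d w a) (d a c) (d x c) (d u a) (d u c) (d a v′) (d v v′) (d w′ w) τ K
              (d-triangle w a x) (≤-trans (d-triangle a c x) (≤-refl ⊕ ≡⇒≤ (d-sym c x)))
              (≤-trans (d-triangle w w′ a) (≡⇒≤ (d-sym w w′) ⊕ ≡⇒≥ (proj₂ (equilateral metric))))
              (level u′∈[u,v] (QuasiMedian.u′∈[u,v] r) p)
              (≤-trans (d-triangle u a v) (≤-refl ⊕ ≤-trans (d-triangle a v′ v) (≤-refl ⊕ ≡⇒≤ (d-sym v′ v))))
              (subst (λ k → d v v′ + k + d w′ w ≤ d v w) (sym (proj₁ (equilateral metric))) vw)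
              (subst₂ (λ s t → d x c + s ≤ t) (d-sym c u) (d-sym x u) (≡⇒≤ (QuasiMedian.u′∈[w,u] r)))
              (side≤K metric)
            where
            open QuasiMedian q renaming (u′ to a)
            c : Fin n
            c = QuasiMedian.u′ r
            arith : ∀ uv wx ux vw wa ac xc ua uc k b e t K →
              wx ≤ wa + d a x → d a x ≤ ac + xc → wa ≤ e + k → ac + ua ≤ t + uc → uv ≤ ua + (k + b) →
              b + k + e ≤ vw → xc + uc ≤ ux → k ≤ K → uv + wx ≤ ux + vw + (t + K)
            arith uv wx ux vw wa ac xc ua uc k b e t K α β γ δ ε ζ η θ =
              linear 0 (≤-trans α (≤-refl {wa} ⊕ β) ⊕ γ ⊕ δ ⊕ ε ⊕ ζ ⊕ η ⊕ θ)
                (solve (uv ◂ wx ◂ ux ◂ vw ◂ wa ◂ ac ◂ xc ◂ ua ◂ uc ◂ k ◂ b ◂ e ◂ t ◂ K ◂ []))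

        -- Which alternative holds depends on which of the two corners in I(u,v) is closer to `u`.
        four-point : ∀ u v w x →
          d u v + d w x ≤ d u w + d v x + (τ + K) ⊎ d u v + d w x ≤ d u x + d v w + (τ + K)
        four-point u v w x
          with ≤-total (d u (QuasiMedian.u′ (quasiMedian u v w))) (d u (QuasiMedian.u′ (quasiMedian u v x)))
        ... | inj₁ p = inj₂ (four-point-ordered (quasiMedian u v w) (quasiMedian u v x) p)
        ... | inj₂ p = inj₁ (subst (λ k → d u v + k ≤ d u w + d v x + (τ + K)) (d-sym x w)
                         (four-point-ordered (quasiMedian u v x) (quasiMedian u v w) p))

        -- Each sum exceeds one of the other two by at most τ + K, hence also the minimum of the
        -- pair, and `mid3` is at least every pairwise minimum.
        hyperbolic : ∀ u v w x →
          let S₁ = d u v + d w x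
              S₂ = d u w + d v x
              S₃ = d u x + d v w
          in max3 G d S₁ S₂ S₃ ≤ mid3 G d S₁ S₂ S₃ + (τ + K)
        hyperbolic u v w x = largest (d u v + d w x) (d u w + d v x) (d u x + d v w) (τ + K)
          (four-point u v w x)
          (subst (λ t → d u w + d v x ≤ d u v + d w x + (τ + K) ⊎ d u w + d v x ≤ d u x + t + (τ + K))
            (d-sym w v) (four-point u w v x))
          (subst₂ (λ s t → d u x + d v w ≤ d u v + s + (τ + K) ⊎ d u x + d v w ≤ d u w + t + (τ + K))
            (d-sym x w) (d-sym x v) (four-point u x v w))
          where
          meet : ∀ {a b h} → a ≤ b + h → a ≤ a ⊓ b + h
          meet {a} {b} {h} p = ≤-trans (⊓-glb (m≤m+n a h) p) (≡⇒≥ (+-distribʳ-⊓ h a b))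
          largest : ∀ a b c h →
            a ≤ b + h ⊎ a ≤ c + h → b ≤ a + h ⊎ b ≤ c + h → c ≤ a + h ⊎ c ≤ b + h →
            max3 G d a b c ≤ mid3 G d a b c + h
          largest a b c h p q r = ⊔-lub (⊔-lub
              (bound p ab ac) (bound q (≤-trans (≡⇒≤ (⊓-comm b a)) ab) bc))
              (bound r (≤-trans (≡⇒≤ (⊓-comm c a)) ac) (≤-trans (≡⇒≤ (⊓-comm c b)) bc))
            where
            m = mid3 G d a b c
            ab : a ⊓ b ≤ m
            ab = m≤m⊔n _ _
            ac : a ⊓ c ≤ m
            ac = ≤-trans (⊓-monoˡ-≤ c (m≤m⊔n a b)) (m≤n⊔m (a ⊓ b) _)
            bc : b ⊓ c ≤ m
            bc = ≤-trans (⊓-monoˡ-≤ c (m≤n⊔m a b)) (m≤n⊔m (a ⊓ b) _)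
            bound : ∀ {s t t′} → s ≤ t + h ⊎ s ≤ t′ + h → s ⊓ t ≤ m → s ⊓ t′ ≤ m → s ≤ m + h
            bound (inj₁ p) k _ = ≤-trans (meet p) (+-monoˡ-≤ h k)
            bound (inj₂ p) _ k = ≤-trans (meet p) (+-monoˡ-≤ h k)

        -- Slimness of geodesic triangles.

        σ : ℕ
        σ = 3 * τ + 2 * K

        -- If d(u,z) + d(z,w) exceeds d(u,w) by at most τ + K, then twice the distance from z to the corner
        -- of the quasi-median of u, w, z at u is at most τ + 2K.
        opaque
          near-corner : ∀ {u w z} → d u z + d z w ≤ d u w + (τ + K) →
            ∃ λ a → a ∈[ u , w ] × (∀ {y} → y ∈[ u , w ] → d u a ≡ d u y → 2 * d z y ≤ σ)
          -- Passing from the corner to `y` on the same level of I(u,w) costs another τ; doubled,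
          -- this turns τ + 2K into `σ`.
          near-corner {u} {w} {z} p = u′ , u′∈[u,v] , λ {y} y∈ e → arith
              (d u z) (d z w) (d u w) (d z y) (d u u′) (d v′ w) (d z w′) (d u′ v′) (d z u′) τ K
              p
              (≤-trans (d-triangle z u′ y) (≤-refl ⊕ thin u′∈[u,v] y∈ e))
              (≤-trans (d-triangle z w′ u′) (≤-refl ⊕ ≡⇒≥ (proj₂ (equilateral metric))))
              (≤-trans (d-triangle u u′ w) (≤-refl ⊕ d-triangle u′ v′ w))
              (subst₂ _≤_ (cong₂ _+_ (cong₂ _+_ (d-sym w v′) (sym (proj₁ (equilateral metric)))) (d-sym w′ z))
                (d-sym w z) vw)
              (subst₂ _≤_ (cong₂ _+_ (cong (d z w′ +_) (sym (proj₂ (equilateral metric)))) (d-sym u′ u))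
                (d-sym z u) wu)
              (side≤K metric)
            where
            open QuasiMedian (quasiMedian u w z)
            arith : ∀ uz zw uw zy a b c k za t K → uz + zw ≤ uw + (t + K) → zy ≤ za + t → za ≤ c + k →
              uw ≤ a + (k + b) → b + k + c ≤ zw → c + k + a ≤ uz → k ≤ K → 2 * zy ≤ 3 * t + 2 * K
            arith uz zw uw zy a b c k za t K α β γ δ ε ζ η =
              linear 0 (α ⊕ β ⊕ β ⊕ γ ⊕ γ ⊕ δ ⊕ ε ⊕ ζ ⊕ η)
                (solve (uz ◂ zw ◂ uw ◂ zy ◂ a ◂ b ◂ c ◂ k ◂ za ◂ t ◂ K ◂ []))

        Near : Fin n → ∀ {a b k} → Walk G a b k → Set
        Near z p = ∃ λ y → OnWalk G y p × 2 * d z y ≤ σ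

        near-forward : ∀ {u w z} (p : Walk G u w (d u w)) → d u z + d z w ≤ d u w + (τ + K) → Near z p
        near-forward {u} {w} p h with near-corner h
        ... | a , a∈ , close with point-at p (≤-trans (m≤m+n (d u a) (d a w)) (≡⇒≤ a∈))
        ...   | y , on , e , y∈ = y , on , close y∈ (sym e)

        -- The side is traversed from `w`, so `y` is chosen by its distance to `w`; inside I(u,w)
        -- this fixes the distance to `u` as well.
        near-backward : ∀ {u w z} (p : Walk G w u (d w u)) → d u z + d z w ≤ d u w + (τ + K) → Near z p
        near-backward {u} {w} p h with near-corner h
        ... | a , a∈ , close
          with point-at p (≤-trans (m≤m+n (d w a) (d a u)) (≡⇒≤ (∈-sym {u} {w} {a} a∈)))
        ...   | y , on , e , y∈ = y , on , close (∈-sym {w} {u} {y} y∈)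
                (+-cancelʳ-≡ (d a w) (d u a) (d u y) (trans a∈ (trans (sym (∈-sym {w} {u} {y} y∈))
                  (cong (d u y +_) (trans (d-sym y w) (trans e (d-sym w a)))))))

        -- As d(u,v) = d(u,z) + d(z,v), each alternative of `four-point` cancels one summand, which
        -- leaves `z` nearly on a geodesic from `w` to `u` or from `w` to `v`.
        near-side : ∀ {u v w z} (q : Walk G v w (d v w)) (r : Walk G w u (d w u)) → z ∈[ u , v ] →
          Near z q ⊎ Near z r
        near-side {u} {v} {w} {z} q r z∈ with four-point u v w z
        ... | inj₁ p = inj₂ (near-backward r (arith (d u z) (d v z) (d z w) (d w z) (d u v) (d u w) (τ + K)
                p (≤-trans (≤-refl ⊕ ≡⇒≤ (d-sym v z)) (≡⇒≤ z∈)) (≡⇒≤ (d-sym z w))))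
          where
          arith : ∀ uz vz zw wz uv uw h → uv + wz ≤ uw + vz + h → uz + vz ≤ uv → zw ≤ wz → uz + zw ≤ uw + h
          arith uz vz zw wz uv uw h α β γ =
            linear 0 (α ⊕ β ⊕ γ) (solve (uz ◂ vz ◂ zw ◂ wz ◂ uv ◂ uw ◂ h ◂ []))
        ... | inj₂ p = inj₁ (near-forward q (arith (d u z) (d v z) (d z w) (d w z) (d u v) (d v w) (τ + K)
                p (≤-trans (≤-refl ⊕ ≡⇒≤ (d-sym v z)) (≡⇒≤ z∈)) (≡⇒≤ (d-sym z w))))
          where
          arith : ∀ uz vz zw wz uv vw h → uv + wz ≤ uz + vw + h → uz + vz ≤ uv → zw ≤ wz → vz + zw ≤ vw + h
          arith uz vz zw wz uv vw h α β γ =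
            linear 0 (α ⊕ β ⊕ γ) (solve (uz ◂ vz ◂ zw ◂ wz ◂ uv ◂ vw ◂ h ◂ []))

-- From natural numbers to rational parameters.

module _ where
  open import Data.Nat as ℕ using (ℕ; suc)
  import Data.Nat.Properties as ℕ
  import Data.Nat.DivMod as ℕ
  open import Data.Integer as ℤ using (+_; +≤+; +<+)
  import Data.Integer.Properties as ℤ
  open import Data.Rational
  open import Data.Rational.Properties
  open import Data.Rational.Solver using (module +-*-Solver)
  open import Data.Rational.Unnormalised as ℚᵘ using (mkℚᵘ; *≡*; *≤*; *<*)
  import Data.Rational.Unnormalised.Properties as ℚᵘ
  open import Data.Product using (∃; _×_; _,_; proj₁; proj₂)
  import Data.Sum as Sum
  open import Relation.Binary.PropositionalEquality
  open import Relation.Nullary using (yes; no; contradiction)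

  fromℕ : ℕ → ℚ
  fromℕ k = + k / 1

  toℚᵘ-fromℕ : ∀ k → toℚᵘ (fromℕ k) ℚᵘ.≃ mkℚᵘ (+ k) 0
  toℚᵘ-fromℕ k = toℚᵘ-fromℚᵘ (mkℚᵘ (+ k) 0)

  fromℕ-+ : ∀ a b → fromℕ (a ℕ.+ b) ≡ fromℕ a + fromℕ b
  fromℕ-+ a b = toℚᵘ-injective (begin
    toℚᵘ (fromℕ (a ℕ.+ b))                ≈⟨ toℚᵘ-fromℕ (a ℕ.+ b) ⟩
    mkℚᵘ (+ (a ℕ.+ b)) 0
      ≈⟨ *≡* (cong (ℤ._* + 1) (sym (cong₂ ℤ._+_ (ℤ.*-identityʳ (+ a)) (ℤ.*-identityʳ (+ b))))) ⟩
    mkℚᵘ (+ a) 0 ℚᵘ.+ mkℚᵘ (+ b) 0        ≈⟨ ℚᵘ.+-cong (toℚᵘ-fromℕ a) (toℚᵘ-fromℕ b) ⟨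
    toℚᵘ (fromℕ a) ℚᵘ.+ toℚᵘ (fromℕ b)    ≈⟨ toℚᵘ-homo-+ (fromℕ a) (fromℕ b) ⟨
    toℚᵘ (fromℕ a + fromℕ b)              ∎)
    where open ℚᵘ.≃-Reasoning

  fromℕ-* : ∀ a b → fromℕ (a ℕ.* b) ≡ fromℕ a * fromℕ b
  fromℕ-* a b = toℚᵘ-injective (begin
    toℚᵘ (fromℕ (a ℕ.* b))                ≈⟨ toℚᵘ-fromℕ (a ℕ.* b) ⟩
    mkℚᵘ (+ (a ℕ.* b)) 0                  ≈⟨ *≡* (cong (ℤ._* + 1) (ℤ.pos-* a b)) ⟩
    mkℚᵘ (+ a) 0 ℚᵘ.* mkℚᵘ (+ b) 0        ≈⟨ ℚᵘ.*-cong (toℚᵘ-fromℕ a) (toℚᵘ-fromℕ b) ⟨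
    toℚᵘ (fromℕ a) ℚᵘ.* toℚᵘ (fromℕ b)    ≈⟨ toℚᵘ-homo-* (fromℕ a) (fromℕ b) ⟨
    toℚᵘ (fromℕ a * fromℕ b)              ∎)
    where open ℚᵘ.≃-Reasoning

  fromℕ-mono-≤ : ∀ {a b} → a ℕ.≤ b → fromℕ a ≤ fromℕ b
  fromℕ-mono-≤ {a} {b} a≤b = toℚᵘ-cancel-≤ (begin
    toℚᵘ (fromℕ a)  ≃⟨ toℚᵘ-fromℕ a ⟩
    mkℚᵘ (+ a) 0    ≤⟨ *≤* (ℤ.*-monoʳ-≤-nonNeg (+ 1) (+≤+ a≤b)) ⟩
    mkℚᵘ (+ b) 0    ≃⟨ toℚᵘ-fromℕ b ⟨
    toℚᵘ (fromℕ b)  ∎)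
    where open ℚᵘ.≤-Reasoning

  fromℕ-cancel-< : ∀ {a b} → fromℕ a < fromℕ b → a ℕ.< b
  fromℕ-cancel-< {a} {b} p with a ℕ.<? b
  ... | yes q = q
  ... | no ¬q = contradiction refl (<⇒≢ (<-≤-trans p (fromℕ-mono-≤ (ℕ.≮⇒≥ ¬q))))

  -- The integer part, computed by dividing the numerator by the denominator.
  natural-part : ∀ {p} → 0ℚ ≤ p → ∃ λ k → fromℕ k ≤ p × p < fromℕ (suc k)
  natural-part {mkℚ ℤ.-[1+ m ] d-1 c} 0≤p = contradiction (drop-*≤* 0≤p) λ ()
  natural-part {p@(mkℚ (+ m) d-1 c)} _ = m ℕ./ suc d-1 , lower , upper
    where
    k = m ℕ./ suc d-1
    lower : fromℕ k ≤ p
    lower = toℚᵘ-cancel-≤ (ℚᵘ.≤-respˡ-≃ (ℚᵘ.≃-sym (toℚᵘ-fromℕ k)) (*≤* (subst₂ ℤ._≤_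
      (ℤ.pos-* k (suc d-1)) (sym (ℤ.*-identityʳ (+ m))) (+≤+ (ℕ.m/n*n≤m m (suc d-1))))))
    upper : p < fromℕ (suc k)
    upper = toℚᵘ-cancel-< (ℚᵘ.<-respʳ-≃ (ℚᵘ.≃-sym (toℚᵘ-fromℕ (suc k))) (*<* (subst₂ ℤ._<_
      (sym (ℤ.*-identityʳ (+ m))) (ℤ.pos-* (suc k) (suc d-1)) (+<+ (begin-strict
        m                                  ≡⟨ ℕ.m≡m%n+[m/n]*n m (suc d-1) ⟩
        m ℕ.% suc d-1 ℕ.+ k ℕ.* suc d-1    <⟨ ℕ.+-monoˡ-< (k ℕ.* suc d-1) (ℕ.m%n<n m (suc d-1)) ⟩
        suc d-1 ℕ.+ k ℕ.* suc d-1          ∎)))))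
      where open ℕ.≤-Reasoning

  -- Natural coefficients are nonnegative, so an affine bound in the integer parts passes to λ and
  -- μ.
  affine : ∀ {l m p q k} a b c → fromℕ l ≤ p → fromℕ m ≤ q → k ℕ.≤ a ℕ.* l ℕ.+ b ℕ.* m ℕ.+ c →
    fromℕ k ≤ fromℕ a * p + fromℕ b * q + fromℕ c
  affine {l} {m} {p} {q} {k} a b c l≤p m≤q k≤ = begin
    fromℕ k                                              ≤⟨ fromℕ-mono-≤ k≤ ⟩
    fromℕ (a ℕ.* l ℕ.+ b ℕ.* m ℕ.+ c)                    ≡⟨ fromℕ-+ (a ℕ.* l ℕ.+ b ℕ.* m) c ⟩
    fromℕ (a ℕ.* l ℕ.+ b ℕ.* m) + fromℕ c
      ≡⟨ cong (_+ fromℕ c) (fromℕ-+ (a ℕ.* l) (b ℕ.* m)) ⟩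
    fromℕ (a ℕ.* l) + fromℕ (b ℕ.* m) + fromℕ c
      ≡⟨ cong (_+ fromℕ c) (cong₂ _+_ (fromℕ-* a l) (fromℕ-* b m)) ⟩
    fromℕ a * fromℕ l + fromℕ b * fromℕ m + fromℕ c
      ≤⟨ +-monoˡ-≤ (fromℕ c) (+-mono-≤ (scale a l≤p) (scale b m≤q)) ⟩
    fromℕ a * p + fromℕ b * q + fromℕ c                  ∎
    where
    open ≤-Reasoning
    scale : ∀ a {x y} → x ≤ y → fromℕ a * x ≤ fromℕ a * y
    scale a = *-monoˡ-≤-nonNeg (fromℕ a) {{nonNegative (fromℕ-mono-≤ {0} {a} ℕ.z≤n)}}

  halve : ∀ {k p} → fromℕ (2 ℕ.* k) ≤ p → fromℕ k ≤ ½ * p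
  halve {k} {p} h = begin
    -- The product `½ * fromℕ 2` evaluates to 1.
    fromℕ k                      ≡⟨ *-identityˡ (fromℕ k) ⟨
    ½ * fromℕ 2 * fromℕ k        ≡⟨ *-assoc ½ (fromℕ 2) (fromℕ k) ⟩
    ½ * (fromℕ 2 * fromℕ k)      ≡⟨ cong (½ *_) (fromℕ-* 2 k) ⟨
    ½ * fromℕ (2 ℕ.* k)          ≤⟨ *-monoˡ-≤-nonNeg ½ h ⟩
    ½ * p                        ∎
    where open ≤-Reasoning

  hyperbolic-form : ∀ p q →
    fromℕ 4 * p + fromℕ 4 * q + fromℕ 2 ≡ (+ 2 / 1) * ((+ 2 / 1) * (p + q) + 1ℚ)
  hyperbolic-form = solve 2 (λ p q →
    con (fromℕ 4) :* p :+ con (fromℕ 4) :* q :+ con (fromℕ 2)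
      := con (+ 2 / 1) :* (con (+ 2 / 1) :* (p :+ q) :+ con 1ℚ)) refl
    where open +-*-Solver

  slim-form₁ : ∀ p q →
    ½ * (fromℕ 13 * p + fromℕ 10 * q + fromℕ 5) ≡ (+ 13 / 2) * p + (+ 5 / 1) * q + (+ 5 / 2)
  slim-form₁ = solve 2 (λ p q →
    con ½ :* (con (fromℕ 13) :* p :+ con (fromℕ 10) :* q :+ con (fromℕ 5))
      := con (+ 13 / 2) :* p :+ con (+ 5 / 1) :* q :+ con (+ 5 / 2)) refl
    where open +-*-Solver

  slim-form₂ : ∀ p q →
    ½ * (fromℕ 12 * p + fromℕ 12 * q + fromℕ 7) ≡ (+ 6 / 1) * (p + q) + (+ 7 / 2)
  slim-form₂ = solve 2 (λ p q →
    con ½ :* (con (fromℕ 12) :* p :+ con (fromℕ 12) :* q :+ con (fromℕ 7))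
      := con (+ 6 / 1) :* (p :+ q) :+ con (+ 7 / 2)) refl
    where open +-*-Solver

  -- Distances are integers: one above L is at least L + 1 and so exceeds λ, and a sum below d(u,x)
  -- + M + 1 is at most d(u,x) + M.
  bow-ℕ : ∀ {n} (G : Graph n) (d : Fin n → Fin n → ℕ) {p q L M} →
    p < fromℕ (suc L) → q < fromℕ (suc M) → BowMetric G d p q →
    ∀ u v w x → InInterval G d v u w → InInterval G d w v x → L ℕ.< d v w →
    d u v ℕ.+ d v w ℕ.+ d w x ℕ.≤ d u x ℕ.+ M
  bow-ℕ G d {p} {q} {L} {M} p< q< bow u v w x v∈ w∈ L<vw =
    ℕ.s≤s⁻¹ (subst (d u v ℕ.+ d v w ℕ.+ d w x ℕ.<_) (ℕ.+-suc (d u x) M) (fromℕ-cancel-< (begin-strict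
      fromℕ (d u v ℕ.+ d v w ℕ.+ d w x)  ≤⟨ bow u v w x v∈ w∈ (<-≤-trans p< (fromℕ-mono-≤ L<vw)) ⟩
      fromℕ (d u x) + q                  <⟨ +-monoʳ-< (fromℕ (d u x)) q< ⟩
      fromℕ (d u x) + fromℕ (suc M)      ≡⟨ fromℕ-+ (d u x) (suc M) ⟨
      fromℕ (d u x ℕ.+ suc M)            ∎)))
    where open ≤-Reasoning

  -- The rational bounds on hyperbolicity and slimness.

  module _ {n : ℕ} (G : Graph n) (d : Fin n → Fin n → ℕ) (dist : IsDistanceFunction G d)
    (meshed : Meshed G d) {p q : ℚ} (0≤p : 0ℚ ≤ p) (0≤q : 0ℚ ≤ q) (bow : BowMetric G d p q) where

    private
      L M : ℕ
      L = proj₁ (natural-part 0≤p)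
      M = proj₁ (natural-part 0≤q)

      L≤p : fromℕ L ≤ p
      L≤p = proj₁ (proj₂ (natural-part 0≤p))

      M≤q : fromℕ M ≤ q
      M≤q = proj₁ (proj₂ (natural-part 0≤q))

      bow′ : ∀ u v w x → InInterval G d v u w → InInterval G d w v x → L ℕ.< d v w →
        d u v ℕ.+ d v w ℕ.+ d w x ℕ.≤ d u x ℕ.+ M
      bow′ = bow-ℕ G d (proj₂ (proj₂ (natural-part 0≤p))) (proj₂ (proj₂ (natural-part 0≤q))) bow

    hyperbolicity : Hyperbolic G d ((+ 2 / 1) * (p + q) + 1ℚ)
    hyperbolicity u v w x = begin
      fromℕ (max3 G d S₁ S₂ S₃)
        ≤⟨ fromℕ-mono-≤ (hyperbolic G d dist meshed L M bow′ u v w x) ⟩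
      fromℕ (mid3 G d S₁ S₂ S₃ ℕ.+ h)
        ≡⟨ fromℕ-+ (mid3 G d S₁ S₂ S₃) h ⟩
      fromℕ (mid3 G d S₁ S₂ S₃) + fromℕ h
        ≤⟨ +-monoʳ-≤ (fromℕ (mid3 G d S₁ S₂ S₃)) (affine {L} {M} 4 4 2 L≤p M≤q (τ+K≤ L M)) ⟩
      fromℕ (mid3 G d S₁ S₂ S₃) + (fromℕ 4 * p + fromℕ 4 * q + fromℕ 2)
        ≡⟨ cong (λ t → fromℕ (mid3 G d S₁ S₂ S₃) + t) (hyperbolic-form p q) ⟩
      fromℕ (mid3 G d S₁ S₂ S₃) + (+ 2 / 1) * ((+ 2 / 1) * (p + q) + 1ℚ)  ∎
      where
      open ≤-Reasoning
      S₁ = d u v ℕ.+ d w x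
      S₂ = d u w ℕ.+ d v x
      S₃ = d u x ℕ.+ d v w
      h = τ G d dist meshed L M bow′ ℕ.+ K G d dist meshed L M bow′

    -- The radius is left open so that both slimness bounds share one argument.
    slimness : ∀ {s} → (∀ k → 2 ℕ.* k ℕ.≤ σ G d dist meshed L M bow′ → fromℕ k ≤ s) → Slim G d s
    slimness {s} bound u v w a b c =
        (λ z on → Sum.map near near (side b c (on-geodesic⇒∈ G d dist on)))
      -- In cyclic order the sides after `b` are `c` and `a`, while `Slim` asks for `a` first.
      , (λ z on → Sum.swap (Sum.map near near (side c a (on-geodesic⇒∈ G d dist on))))
      , (λ z on → Sum.map near near (side a b (on-geodesic⇒∈ G d dist on)))
      where
      side = λ {u} {v} {w} {z} → near-side G d dist meshed L M bow′ {u} {v} {w} {z}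
      near : ∀ {z a b k} {r : Walk G a b k} → Near G d dist meshed L M bow′ z r → NearWalk G d s z r
      near {z} (y , on , h) = y , on , bound (d z y) h

    slimness₁ : Slim G d ((+ 13 / 2) * p + (+ 5 / 1) * q + (+ 5 / 2))
    slimness₁ = slimness λ k h → subst (fromℕ k ≤_) (slim-form₁ p q)
      (halve {k} (affine {L} {M} {k = 2 ℕ.* k} 13 10 5 L≤p M≤q (ℕ.≤-trans h (σ≤₁ L M))))

    slimness₂ : Slim G d ((+ 6 / 1) * (p + q) + (+ 7 / 2))
    slimness₂ = slimness λ k h → subst (fromℕ k ≤_) (slim-form₂ p q)
      (halve {k} (affine {L} {M} {k = 2 ℕ.* k} 12 12 7 L≤p M≤q (ℕ.≤-trans h (σ≤₂ L M))))

open import Data.Integer using (+_)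
open import Data.Rational using (ℚ; _/_; _≤_; _+_; _*_; 0ℚ; 1ℚ)
open import Data.Product using (_×_; _,_)
open import Relation.Nullary using (¬_)

theorem4 : (λ' μ : ℚ) → 0ℚ ≤ λ' → 0ℚ ≤ μ →
    {n : ℕ} (G : Graph n) (d : Fin n → Fin n → ℕ) →
    IsDistanceFunction G d → Meshed G d → BowMetric G d λ' μ →
    Hyperbolic G d ((+ 2 / 1) * (λ' + μ) + 1ℚ)
    × (λ' ≤ (+ 2 / 1) * (μ + 1ℚ) → Slim G d ((+ 13 / 2) * λ' + (+ 5 / 1) * μ + (+ 5 / 2)))
    × (¬ (λ' ≤ (+ 2 / 1) * (μ + 1ℚ)) → Slim G d ((+ 6 / 1) * (λ' + μ) + (+ 7 / 2)))
theorem4 λ' μ 0≤λ' 0≤μ G d dist meshed bow =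
    hyperbolicity G d dist meshed 0≤λ' 0≤μ bow
  , (λ _ → slimness₁ G d dist meshed 0≤λ' 0≤μ bow)
  , (λ _ → slimness₂ G d dist meshed 0≤λ' 0≤μ bow)
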